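{- Let $G = (I \cup C, E)$ be a word-representable split graph (so $V = I \cup C$ with $I$ an independent set and $C$ a clique). Then $\mathcal{R}(G) \le 3$.
   Context: For a word $w$ over a finite alphabet and letters $a,b$, $w|_{\{a,b\}}$ denotes the subsequence of $w$ consisting of all occurrences of $a$ and $b$; $a$ and $b$ alternate in $w$ if $w|_{\{a,b\}}$ is of the form $abab\cdots$ or $baba\cdots$ (of even or odd length). A graph $G=(V,E)$ is word-representable if there is a word $w$ over $V$ such that for all distinct $a,b\in V$, $ab\in E$ if and only if $a$ and $b$ alternate in $w$. A word is $k$-uniform if every letter occurs in it exactly $k$ times. The representation number $\mathcal{R}(G)$ of a word-representable graph $G$ is the smallest $k$ such that some $k$-uniform word represents $G$. A split graph is a graph whose vertex set can be partitioned into a clique and an independent set. -}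

module Defs where

open import Data.Nat using (ℕ; _≤_; suc)
open import Data.Fin using (Fin; _≟_)
open import Data.Bool using (Bool; true; false; _∨_; T)
open import Data.List using (List; []; _∷_; filter; length)
open import Data.List.Relation.Unary.Any using (Any)
open import Data.Product using (Σ; _×_; ∃-syntax)
open import Data.Sum using (_⊎_)
open import Relation.Nullary using (¬_; Dec; yes; no)
open import Relation.Nullary.Decidable using (⌊_⌋)
open import Relation.Binary.PropositionalEquality using (_≡_)
open import Relation.Unary using (Pred)

record Graph (n : ℕ) : Set₁ where
  field
    Adj   : Fin n → Fin n → Set
    sym   : ∀ {x y} → Adj x y → Adj y x
    irrefl : ∀ {x} → ¬ Adj x x

open Graph public

Word : ℕ → Set
Word n = List (Fin n)

isAB : ∀ {n} → Fin n → Fin n → Fin n → Bool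
isAB a b x = ⌊ x ≟ a ⌋ ∨ ⌊ x ≟ b ⌋

restrict : ∀ {n} → Fin n → Fin n → Word n → Word n
restrict a b [] = []
restrict a b (x ∷ w) with isAB a b x
... | true  = x ∷ restrict a b w
... | false = restrict a b w

-- A word (over {a,b}) of the form abab... or baba...: no two consecutive letters equal.
data Alternating {n : ℕ} : Word n → Set where
  alt-[]  : Alternating []
  alt-[x] : ∀ x → Alternating (x ∷ [])
  alt-∷   : ∀ x y w → ¬ (x ≡ y) → Alternating (y ∷ w) → Alternating (x ∷ y ∷ w)

Alternate : ∀ {n} → Word n → Fin n → Fin n → Set
Alternate w a b = Alternating (restrict a b w)

count : ∀ {n} → Fin n → Word n → ℕ
count x [] = 0
count x (y ∷ w) with x ≟ y
... | yes _ = suc (count x w)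
... | no  _ = count x w

Represents : ∀ {n} → Graph n → Word n → Set
Represents G w = ∀ a b → ¬ (a ≡ b) → (Adj G a b → Alternate w a b) × (Alternate w a b → Adj G a b)

WordRepresentable : ∀ {n} → Graph n → Set
WordRepresentable {n} G = ∃[ w ] Represents G w

Uniform : ∀ {n} → ℕ → Word n → Set
Uniform k w = ∀ x → count x w ≡ k

KRepresentable : ∀ {n} → ℕ → Graph n → Set
KRepresentable k G = ∃[ w ] (Uniform k w × Represents G w)

IsSplitPartition : ∀ {n} → Graph n → (Fin n → Bool) → Set
IsSplitPartition G inC =
  (∀ a b → inC a ≡ true → inC b ≡ true → ¬ (a ≡ b) → Adj G a b) ×
  (∀ a b → inC a ≡ false → inC b ≡ false → ¬ Adj G a b)

IsSplit : ∀ {n} → Graph n → Set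
IsSplit {n} G = ∃[ inC ] IsSplitPartition G inC

{-# OPTIONS --safe #-}

-- Order the vertices by their first occurrence in a word representing G, and let
-- x be independent.  The clique letters recur cyclically, and semi-transitivity of
-- the order shows that the neighbours of x form a cyclic arc: an interval when x
-- comes after (or before) all of them, an initial plus a final segment otherwise.
-- If the complementary closed gaps of x and y were disjoint, x and y would be
-- forced to alternate, so the gaps meet pairwise.  The gaps not containing the
-- origin are intervals, hence by Helly they share a point g.
--
-- Go three times round the clique and insert each x once per round, at points of
-- its gap that include both ends; then x alternates with exactly its neighbours.
-- Gaps [-s, t] through the origin use t, 0, -s, the other gaps [c, d] use c, d, g.
-- The points 0 and g are shared, and listing the letters there in reverse order
-- keeps letters of the same kind from alternating; for letters of different kinds
-- it is the meeting of their gaps that breaks the alternation.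

module Submission where

open import Defs
open import Data.Nat using (ℕ; zero; suc; _+_; _*_; _≤_; _<_; _⊔_; _⊓_; _≤′_;
  ≤′-refl; ≤′-step; z≤n; s≤s; s≤s⁻¹; s<s⁻¹)
open import Data.Nat.Properties as ℕₚ using (≤-refl; ≤-trans; ≤-reflexive)
open import Data.Fin as F using (Fin; zero; suc; toℕ; fromℕ<; opposite; combine; #_; _≟_)
open import Data.Fin.Properties as Fₚ using (any?; toℕ<n; toℕ-fromℕ<; toℕ-injective;
  opposite-prop; opposite-involutive)
open import Data.List using (List; []; _∷_; _++_; length)
open import Data.List.Properties using (∷-injectiveˡ; ∷-injectiveʳ; ++-identityʳ; ++-assoc)
open import Data.Product using (_×_; _,_; proj₁; proj₂; ∃; ∃-syntax)
open import Data.Sum as Sum using (_⊎_; inj₁; inj₂; [_,_]′; swap)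
open import Data.Bool using (Bool; true; false; _∨_; if_then_else_)
import Data.Bool.Properties as Boolₚ
open import Data.Empty using (⊥; ⊥-elim)
open import Data.Unit using (⊤; tt)
open import Function using (_∘_; _⇔_; mk⇔; Equivalence)
open import Function.Construct.Composition using (_⇔-∘_)
open import Relation.Binary.Definitions using (tri<; tri≈; tri>)
open import Relation.Nullary using (¬_; Dec; yes; no)
open import Relation.Nullary.Decidable using (True; toWitness; ⌊_⌋; map′; _×-dec_)
open import Relation.Unary using (Decidable)
open import Relation.Binary.PropositionalEquality
  using (_≡_; _≢_; ≢-sym; refl; trans; cong; subst; subst₂)
  renaming (sym to ≡-sym)

-- Alternation with a prescribed leading letter.

-- a and b alternate in w with a first; equivalently, every prefix of w contains
-- as many a's as b's, or one more.
data Lead {n} : Word n → Fin n → Fin n → Set where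
  done : ∀ {a b} → Lead [] a b
  turn : ∀ {a b w} → Lead w b a → Lead (a ∷ w) a b
  skip : ∀ {a b x w} → x ≢ a → x ≢ b → Lead w a b → Lead (x ∷ w) a b

-- The prepended letter stands for the one read last, so the other one is due. The two halves are
-- proved together because reading a letter exchanges them.
lead-after : ∀ {n} {a b : Fin n} → a ≢ b → ∀ w →
  (Alternating (a ∷ restrict a b w) → Lead w b a) ×
  (Alternating (b ∷ restrict a b w) → Lead w a b)
lead-after a≢b [] = (λ _ → done) , (λ _ → done)
lead-after {a = a} {b} a≢b (x ∷ w) with x ≟ a | x ≟ b
... | yes refl | yes refl = ⊥-elim (a≢b refl)
... | yes refl | no _ = (λ { (alt-∷ _ _ _ a≢a _) → ⊥-elim (a≢a refl) })
                      , (λ { (alt-∷ _ _ _ _ alt) → turn (proj₁ (lead-after a≢b w) alt) })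
... | no _ | yes refl = (λ { (alt-∷ _ _ _ _ alt) → turn (proj₂ (lead-after a≢b w) alt) })
                      , (λ { (alt-∷ _ _ _ b≢b _) → ⊥-elim (b≢b refl) })
... | no x≢a | no x≢b = (skip x≢b x≢a ∘ proj₁ (lead-after a≢b w))
                      , (skip x≢a x≢b ∘ proj₂ (lead-after a≢b w))

alternate⇒lead : ∀ {n} {a b : Fin n} → a ≢ b → ∀ w → Alternate w a b → Lead w a b ⊎ Lead w b a
alternate⇒lead a≢b [] _ = inj₁ done
alternate⇒lead {a = a} {b} a≢b (x ∷ w) alt with x ≟ a | x ≟ b
... | yes refl | yes refl = ⊥-elim (a≢b refl)
... | yes refl | no _ = inj₁ (turn (proj₁ (lead-after a≢b w) alt))
... | no _ | yes refl = inj₂ (turn (proj₂ (lead-after a≢b w) alt))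
... | no x≢a | no x≢b with alternate⇒lead a≢b w alt
...   | inj₁ l = inj₁ (skip x≢a x≢b l)
...   | inj₂ l = inj₂ (skip x≢b x≢a l)

after-lead : ∀ {n} {a b : Fin n} → a ≢ b → ∀ w →
  (Lead w b a → Alternating (a ∷ restrict a b w)) ×
  (Lead w a b → Alternating (b ∷ restrict a b w))
after-lead a≢b [] = (λ _ → alt-[x] _) , (λ _ → alt-[x] _)
after-lead {a = a} {b} a≢b (x ∷ w) with x ≟ a | x ≟ b
... | yes refl | yes refl = ⊥-elim (a≢b refl)
... | yes refl | no a≢b′ =
        (λ { (turn _) → ⊥-elim (a≢b refl) ; (skip _ a≢a _) → ⊥-elim (a≢a refl) })
      , (λ { (turn l) → alt-∷ _ _ _ (≢-sym a≢b) (proj₁ (after-lead a≢b w) l)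
           ; (skip a≢a _ _) → ⊥-elim (a≢a refl) })
... | no _ | yes refl =
        (λ { (turn l) → alt-∷ _ _ _ a≢b (proj₂ (after-lead a≢b w) l)
           ; (skip b≢b _ _) → ⊥-elim (b≢b refl) })
      , (λ { (turn _) → ⊥-elim (a≢b refl) ; (skip _ b≢b _) → ⊥-elim (b≢b refl) })
... | no x≢a | no x≢b =
        (λ { (turn _) → ⊥-elim (x≢b refl) ; (skip _ _ l) → proj₁ (after-lead a≢b w) l })
      , (λ { (turn _) → ⊥-elim (x≢a refl) ; (skip _ _ l) → proj₂ (after-lead a≢b w) l })

alternating-tail : ∀ {n x} {w : Word n} → Alternating (x ∷ w) → Alternating w
alternating-tail (alt-[x] _) = alt-[]
alternating-tail (alt-∷ _ _ _ _ alt) = alt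

lead⇒alternate : ∀ {n} {a b : Fin n} → a ≢ b → ∀ w → Lead w a b ⊎ Lead w b a → Alternate w a b
lead⇒alternate a≢b w (inj₁ l) = alternating-tail (proj₂ (after-lead a≢b w) l)
lead⇒alternate a≢b w (inj₂ l) = alternating-tail (proj₁ (after-lead a≢b w) l)

alternating? : ∀ {n} (w : Word n) → Dec (Alternating w)
alternating? [] = yes alt-[]
alternating? (x ∷ []) = yes (alt-[x] x)
alternating? (x ∷ y ∷ w) with x ≟ y | alternating? (y ∷ w)
... | yes x≡y | _ = no λ { (alt-∷ _ _ _ x≢y _) → x≢y x≡y }
... | no x≢y | yes alt = yes (alt-∷ x y w x≢y alt)
... | no _ | no ¬alt = no (¬alt ∘ alternating-tail)

-- Prefix counts and semi-transitivity.

-- The half of `Lead` that is a preorder and therefore composes along paths.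
Dominates : ∀ {n} → Word n → Fin n → Fin n → Set
Dominates w a b = ∀ p s → w ≡ p ++ s → count b p ≤ count a p

lead-counts : ∀ {n} {w : Word n} {a b} → Lead w a b → ∀ p s → w ≡ p ++ s →
  count b p ≤ count a p × count a p ≤ suc (count b p)
lead-counts l [] s eq = z≤n , z≤n
lead-counts {a = a} {b} (turn l) (y ∷ p) s refl with b ≟ a | a ≟ a
... | yes refl | yes _ = ≤-refl , ℕₚ.n≤1+n _
... | _ | no a≢a = ⊥-elim (a≢a refl)
... | no b≢a | yes _ = let lo , hi = lead-counts l p s refl in hi , s≤s lo
lead-counts {a = a} {b} (skip y≢a y≢b l) (y ∷ p) s refl with b ≟ y | a ≟ y
... | yes refl | _ = ⊥-elim (y≢b refl)
... | no _ | yes refl = ⊥-elim (y≢a refl)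
... | no _ | no _ = lead-counts l p s refl

lead⇒dominates : ∀ {n} {w : Word n} {a b} → Lead w a b → Dominates w a b
lead⇒dominates l p s eq = proj₁ (lead-counts l p s eq)

counts-lead : ∀ {n} {a b : Fin n} → a ≢ b → ∀ w →
  (∀ p s → w ≡ p ++ s → count b p ≤ count a p × count a p ≤ suc (count b p)) → Lead w a b
counts-lead a≢b [] h = done
counts-lead {a = a} {b} a≢b (x ∷ w) h with x ≟ a | x ≟ b
... | yes refl | yes refl = ⊥-elim (a≢b refl)
... | yes refl | no _ = turn (counts-lead (≢-sym a≢b) w h′)
  where
  h′ : ∀ p s → w ≡ p ++ s → count a p ≤ count b p × count b p ≤ suc (count a p)
  h′ p s refl with h (a ∷ p) s refl
  ... | lo , hi with b ≟ a | a ≟ a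
  ...   | yes refl | _ = ⊥-elim (a≢b refl)
  ...   | _ | no a≢a = ⊥-elim (a≢a refl)
  ...   | no _ | yes _ = s≤s⁻¹ hi , lo
-- The prefix consisting of b alone would contain more b's than a's.
... | no _ | yes refl with proj₁ (h (b ∷ []) w refl)
...   | le with b ≟ b | a ≟ b
...     | no b≢b | _ = ⊥-elim (b≢b refl)
...     | _ | yes refl = ⊥-elim (a≢b refl)
...     | yes _ | no _ with () ← le
counts-lead {a = a} {b} a≢b (x ∷ w) h | no x≢a | no x≢b = skip x≢a x≢b (counts-lead a≢b w h′)
  where
  h′ : ∀ p s → w ≡ p ++ s → count b p ≤ count a p × count a p ≤ suc (count b p)
  h′ p s refl with h (x ∷ p) s refl
  ... | bounds with b ≟ x | a ≟ x
  ...   | yes refl | _ = ⊥-elim (x≢b refl)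
  ...   | no _ | yes refl = ⊥-elim (x≢a refl)
  ...   | no _ | no _ = bounds

-- Semi-transitivity of the orientation "leads": along a path from a to d, the edge
-- from a to d forces the edge from b to c.
squeeze : ∀ {n} {w : Word n} {a b c d} → b ≢ c → Lead w a d →
  Dominates w a b → Dominates w b c → Dominates w c d → Lead w b c
squeeze {w = w} b≢c l ab bc cd = counts-lead b≢c w λ p s eq →
  bc p s eq ,
  ≤-trans (ab p s eq) (≤-trans (proj₂ (lead-counts l p s eq)) (s≤s (cd p s eq)))

-- First occurrences.

-- Letters missing from w are placed after its end, which keeps first injective.
first : ∀ {n} → Word n → Fin n → ℕ
first [] a = toℕ a
first (x ∷ w) a with x ≟ a
... | yes _ = 0
... | no _ = suc (first w a)

first-injective : ∀ {n} (w : Word n) {a b} → first w a ≡ first w b → a ≡ b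
first-injective [] eq = toℕ-injective eq
first-injective (x ∷ w) {a} {b} eq with x ≟ a | x ≟ b
... | yes refl | yes refl = refl
... | no _ | no _ = first-injective w (ℕₚ.suc-injective eq)


first< : ∀ {n} (w : Word n) a → first w a < length w + n
first< [] a = toℕ<n a
first< (x ∷ w) a with x ≟ a
... | yes _ = s≤s z≤n
... | no _ = s≤s (first< w a)

-- If either letter occurred, b would occur first, against the order of `first`. So w contains
-- neither letter, and then each leads the other.
lead-by-first : ∀ {n} {w : Word n} {a b} → first w a < first w b → Lead w b a → Lead w a b
lead-by-first _ done = done
lead-by-first {a = a} {b} a<b (turn l) with b ≟ b
... | yes _ with () ← a<b
... | no b≢b = ⊥-elim (b≢b refl)
lead-by-first {w = x ∷ w} {a} {b} a<b (skip x≢b x≢a l) with x ≟ a | x ≟ b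
... | yes refl | _ = ⊥-elim (x≢a refl)
... | no _ | yes refl = ⊥-elim (x≢b refl)
... | no _ | no _ = skip x≢a x≢b (lead-by-first (s<s⁻¹ a<b) l)

-- Words written from timetables.

count-∷ʳ-≡ : ∀ {n} (v : Fin n) w → count v (w ++ v ∷ []) ≡ suc (count v w)
count-∷ʳ-≡ v [] with v ≟ v
... | yes _ = refl
... | no v≢v = ⊥-elim (v≢v refl)
count-∷ʳ-≡ v (x ∷ w) with v ≟ x
... | yes _ = cong suc (count-∷ʳ-≡ v w)
... | no _ = count-∷ʳ-≡ v w

count-∷ʳ-≢ : ∀ {n} {v u : Fin n} → v ≢ u → ∀ w → count v (w ++ u ∷ []) ≡ count v w
count-∷ʳ-≢ {v = v} {u} v≢u [] with v ≟ u
... | yes v≡u = ⊥-elim (v≢u v≡u)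
... | no _ = refl
count-∷ʳ-≢ {v = v} v≢u (x ∷ w) with v ≟ x
... | yes _ = cong suc (count-∷ʳ-≢ v≢u w)
... | no _ = count-∷ʳ-≢ v≢u w

prefix-∷ʳ : ∀ {A : Set} (w : List A) {x} p {s} → w ++ x ∷ [] ≡ p ++ s →
  (p ≡ w ++ x ∷ []) ⊎ (∃[ s′ ] w ≡ p ++ s′)
prefix-∷ʳ w [] eq = inj₂ (w , refl)
prefix-∷ʳ [] (y ∷ []) refl = inj₁ refl
prefix-∷ʳ (z ∷ w) (y ∷ p) eq with ∷-injectiveˡ eq | prefix-∷ʳ w p (∷-injectiveʳ eq)
... | refl | inj₁ p≡ = inj₁ (cong (z ∷_) p≡)
... | refl | inj₂ (s′ , w≡) = inj₂ (s′ , cong (z ∷_) w≡)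

-- For increasing sequences: x 0 ≤ y 0 ≤ x 1 ≤ y 1 ≤ …
_≺_ : ∀ {k} → (Fin k → ℕ) → (Fin k → ℕ) → Set
x ≺ y = (∀ j → x j ≤ y j) × (∀ {i j} → i F.< j → y i ≤ x j)

-- `key v i` is the time at which v is written for the i-th time, counting from 0. Different letters
-- never share a time, so at most one letter is written per tick.
module Schedule {n k} (key : Fin n → Fin k → ℕ)
  (key-mono : ∀ v {i j} → i F.< j → key v i < key v j)
  (key-injective : ∀ {u v} i j → key u i ≡ key v j → u ≡ v) where

  event? : ∀ τ → Dec (∃[ v ] ∃[ i ] key v i ≡ τ)
  event? τ = any? λ v → any? λ i → key v i ℕₚ.≟ τ

  play : ℕ → Word n
  play zero = []
  play (suc τ) with event? τ
  ... | yes (v , _) = play τ ++ v ∷ []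
  ... | no _ = play τ

  key-cancel-< : ∀ v {i j} → key v i < key v j → i F.< j
  key-cancel-< v {i} {j} lt with Fₚ.<-cmp i j
  ... | tri< i<j _ _ = i<j
  ... | tri≈ _ refl _ = ⊥-elim (ℕₚ.<-irrefl refl lt)
  ... | tri> _ _ j<i = ⊥-elim (ℕₚ.<-asym lt (key-mono v j<i))

  -- m is the number of keys of v below τ.
  record Tally (v : Fin n) (τ m : ℕ) : Set where
    field
      ≤k : m ≤ k
      played : ∀ {j} → toℕ j < m → key v j < τ
      counted : ∀ {j} → key v j < τ → toℕ j < m

  open Tally

  tally-idle : ∀ {v τ m} → (∀ j → key v j ≢ τ) → Tally v τ m → Tally v (suc τ) m
  tally-idle idle t .≤k = t .≤k
  tally-idle idle t .played j<m = ℕₚ.m<n⇒m<1+n (t .played j<m)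
  tally-idle idle t .counted lt = t .counted (ℕₚ.≤∧≢⇒< (s≤s⁻¹ lt) (idle _))

  -- Here m must equal i: if m were smaller, key m would be earlier than key i and yet uncounted; if
  -- larger, key i would precede itself.
  tally-event : ∀ {v m} i → Tally v (key v i) m → Tally v (suc (key v i)) (suc m)
  tally-event {v} {m} i t with ℕₚ.<-cmp m (toℕ i)
  ... | tri< m<i _ _ = ⊥-elim (ℕₚ.<-irrefl (toℕ-fromℕ< m<k)
          (t .counted (key-mono v (subst (_< toℕ i) (≡-sym (toℕ-fromℕ< m<k)) m<i))))
    where m<k = ℕₚ.<-trans m<i (toℕ<n i)
  ... | tri> _ _ i<m = ⊥-elim (ℕₚ.<-irrefl refl (t .played i<m))
  ... | tri≈ _ refl _ = record
    { ≤k = toℕ<n i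
    ; played = λ j<1+i → s≤s (ℕₚ.≮⇒≥ λ lt → ℕₚ.<⇒≱ (key-cancel-< v lt) (s≤s⁻¹ j<1+i))
    ; counted = λ lt → s≤s (ℕₚ.≮⇒≥ λ i<j → ℕₚ.<⇒≱ (key-mono v i<j) (s≤s⁻¹ lt))
    }

  tally : ∀ v τ → Tally v τ (count v (play τ))
  tally v zero = record { ≤k = z≤n ; played = λ () ; counted = λ () }
  tally v (suc τ) with event? τ | tally v τ
  ... | no none | t = tally-idle (λ j eq → none (v , j , eq)) t
  ... | yes (u , i , refl) | t with v ≟ u
  ...   | yes refl = subst (Tally v _) (≡-sym (count-∷ʳ-≡ v (play (key u i)))) (tally-event i t)
  ...   | no v≢u = subst (Tally v _) (≡-sym (count-∷ʳ-≢ v≢u (play (key u i))))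
                     (tally-idle (λ j eq → v≢u (key-injective j i eq)) t)

  -- Turns the prefix conditions of `counts-lead` into comparisons of key times.
  prefix-play : ∀ N p s → play N ≡ p ++ s → ∃[ τ ] p ≡ play τ
  prefix-play zero [] s eq = 0 , refl
  prefix-play (suc N) p s eq with event? N in found
  ... | no _ = prefix-play N p s eq
  ... | yes (v , _) with prefix-∷ʳ (play N) p eq
  ...   | inj₂ (s′ , eq′) = prefix-play N p s′ eq′
  ...   | inj₁ refl = suc N , play-suc
    where
    play-suc : play N ++ v ∷ [] ≡ play (suc N)
    play-suc rewrite found = refl

  play-prefix : ∀ {τ N} → τ ≤′ N → ∃[ s ] play N ≡ play τ ++ s
  play-prefix ≤′-refl = [] , ≡-sym (++-identityʳ _)
  play-prefix {τ} {suc N} (≤′-step le) with event? N | play-prefix le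
  ... | no _ | found = found
  ... | yes (v , _) | s , eq = s ++ v ∷ [] ,
          trans (cong (_++ v ∷ []) eq) (++-assoc (play τ) s (v ∷ []))

  play-uniform : ∀ {N} → (∀ v j → key v j < N) → Uniform k (play N)
  play-uniform {N} key<N v = ℕₚ.≤-antisym (tally v N .≤k) (ℕₚ.≮⇒≥ λ lt →
    ℕₚ.<-irrefl (toℕ-fromℕ< lt) (tally v N .counted (key<N v (fromℕ< lt))))

  ≺⇒lead : ∀ {a b} → a ≢ b → key a ≺ key b → ∀ N → Lead (play N) a b
  ≺⇒lead {a} {b} a≢b (a≤b , b≤a) N = counts-lead a≢b (play N) bounds
    where
    bounds : ∀ p s → play N ≡ p ++ s → count b p ≤ count a p × count a p ≤ suc (count b p)
    bounds p s eq with prefix-play N p s eq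
    ... | τ , refl = ℕₚ.≮⇒≥ behind , ℕₚ.≮⇒≥ ahead
      where
      -- With i the count of a, key i of b has passed, hence so has key i of a, which is one more
      -- than was counted.
      behind : ¬ count a (play τ) < count b (play τ)
      behind lt = ℕₚ.<-irrefl (toℕ-fromℕ< i<k) (tally a τ .counted
        (ℕₚ.≤-<-trans (a≤b (fromℕ< i<k)) (tally b τ .played (subst (_< _) (≡-sym (toℕ-fromℕ< i<k)) lt))))
        where i<k = ℕₚ.<-≤-trans lt (tally b τ .≤k)

      -- With i the count of b and j = i + 1, key j of a has passed, hence so has key i of b, again
      -- one too many.
      ahead : ¬ suc (count b (play τ)) < count a (play τ)
      ahead lt = ℕₚ.<-irrefl (toℕ-fromℕ< i<k) (tally b τ .counted
        (ℕₚ.≤-<-trans (b≤a i<j) (tally a τ .played (subst (_< _) (≡-sym (toℕ-fromℕ< j<k)) lt))))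
        where
        j<k = ℕₚ.<-≤-trans lt (tally a τ .≤k)
        i<k = ℕₚ.<-trans ≤-refl j<k
        i<j : fromℕ< i<k F.< fromℕ< j<k
        i<j = subst₂ _<_ (≡-sym (toℕ-fromℕ< i<k)) (≡-sym (toℕ-fromℕ< j<k)) ≤-refl

  -- The count bounds are read just after a single key: key j of b for `a≤b`, key j of a for `b≤a`.
  lead⇒≺ : ∀ {a b N} → (∀ v j → key v j < N) → Lead (play N) a b → key a ≺ key b
  lead⇒≺ {a} {b} {N} key<N l = a≤b , b≤a
    where
    bounds : ∀ v j → let p = play (suc (key v j)) in
      count b p ≤ count a p × count a p ≤ suc (count b p)
    bounds v j = let s , eq = play-prefix (ℕₚ.≤⇒≤′ (key<N v j)) in lead-counts l _ s eq

    a≤b : ∀ j → key a j ≤ key b j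
    a≤b j = s≤s⁻¹ (tally a _ .played (ℕₚ.<-≤-trans (tally b _ .counted ≤-refl) (proj₁ (bounds b j))))

    b≤a : ∀ {i j} → i F.< j → key b i ≤ key a j
    b≤a {i} {j} i<j = s≤s⁻¹ (tally b _ .played (ℕₚ.<-≤-trans i<j
      (s≤s⁻¹ (≤-trans (tally a _ .counted ≤-refl) (proj₂ (bounds a j))))))

-- Lexicographic order encoded in numbers.

lex : ∀ N → ℕ → Fin N → ℕ
lex N m i = m * N + toℕ i

lex-<ˡ : ∀ {N m m′} → m < m′ → (i j : Fin N) → lex N m i < lex N m′ j
lex-<ˡ {N} {m} {m′} m<m′ i j = begin-strict
  m * N + toℕ i   <⟨ ℕₚ.+-monoʳ-< (m * N) (toℕ<n i) ⟩
  m * N + N       ≡⟨ ℕₚ.+-comm (m * N) N ⟩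
  suc m * N       ≤⟨ ℕₚ.*-monoˡ-≤ N m<m′ ⟩
  m′ * N          ≤⟨ ℕₚ.m≤m+n (m′ * N) (toℕ j) ⟩
  m′ * N + toℕ j  ∎
  where open ℕₚ.≤-Reasoning

lex-<ʳ : ∀ {N m m′} {i j : Fin N} → m ≤ m′ → i F.< j → lex N m i < lex N m′ j
lex-<ʳ {N} m≤m′ i<j = ℕₚ.+-mono-≤-< (ℕₚ.*-monoˡ-≤ N m≤m′) i<j

lex-injective : ∀ {N} m m′ (i j : Fin N) → lex N m i ≡ lex N m′ j → m ≡ m′ × i ≡ j
lex-injective {N} m m′ i j eq with ℕₚ.<-cmp m m′
... | tri< m<m′ _ _ = ⊥-elim (ℕₚ.<⇒≢ (lex-<ˡ m<m′ i j) eq)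
... | tri≈ _ refl _ = refl , toℕ-injective (ℕₚ.+-cancelˡ-≡ (m * N) _ _ eq)
... | tri> _ _ m′<m = ⊥-elim (ℕₚ.<⇒≢ (lex-<ˡ m′<m j i) (≡-sym eq))

-- Shapes on the circle and interlacing triples.

-- Where a vertex sits relative to the clique: point p is the clique vertex at
-- position p; inner a b and outer c d are independent vertices adjacent to the
-- clique positions in [a, b), respectively outside [c, d).  On the circle of length
-- K their gaps are [b - K, a] and [c, d].
data Shape : Set where
  point : ℕ → Shape
  inner outer : ℕ → ℕ → Shape

Touch : Shape → Shape → Set
Touch (point _) (point _) = ⊤
Touch (point p) (inner a b) = a ≤ p × p < b
Touch (inner a b) (point p) = a ≤ p × p < b
Touch (point p) (outer c d) = p < c ⊎ d ≤ p
Touch (outer c d) (point p) = p < c ⊎ d ≤ p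
Touch _ _ = ⊥

-- In the mixed case this says that the gaps meet: modulo K, the gap of `inner a b` consists of
-- [0, a] and [b, K]. Gaps of the same kind share the origin or g.
Compatible : Shape → Shape → Set
Compatible (point p) (point q) = p ≢ q
Compatible (inner a b) (outer c d) = c ≤ a ⊎ b ≤ d
Compatible (outer c d) (inner a b) = c ≤ a ⊎ b ≤ d
Compatible _ _ = ⊤

-- The slot of the first occurrence. Ranks will respect it, so that first insertions of the same
-- kind come in rank order.
start : Shape → ℕ
start (point p) = p
start (inner a _) = a
start (outer c _) = c

pattern 0F = zero
pattern 1F = suc zero
pattern 2F = suc (suc zero)

ascending : (x : Fin 3 → ℕ) → x 0F < x 1F → x 1F < x 2F → ∀ {i j} → i F.< j → x i < x j
ascending x p q {0F} {1F} _ = p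
ascending x p q {0F} {2F} _ = ℕₚ.<-trans p q
ascending x p q {1F} {2F} _ = q
ascending x p q {0F} {0F} ()
ascending x p q {1F} {0F} ()
ascending x p q {1F} {1F} (s≤s ())
ascending x p q {2F} {0F} ()
ascending x p q {2F} {1F} (s≤s ())
ascending x p q {2F} {2F} (s≤s (s≤s ()))

interlaced : (x y : Fin 3 → ℕ) →
  x 0F < y 0F → y 0F < x 1F → x 1F < y 1F → y 1F < x 2F → x 2F < y 2F → x ≺ y
interlaced x y p q r s t = below , above
  where
  below : ∀ j → x j ≤ y j
  below 0F = ℕₚ.<⇒≤ p
  below 1F = ℕₚ.<⇒≤ r
  below 2F = ℕₚ.<⇒≤ t

  above : ∀ {i j} → i F.< j → y i ≤ x j
  above {0F} {1F} _ = ℕₚ.<⇒≤ q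
  above {0F} {2F} _ = ℕₚ.<⇒≤ (ℕₚ.<-trans q (ℕₚ.<-trans r s))
  above {1F} {2F} _ = ℕₚ.<⇒≤ s
  above {0F} {0F} ()
  above {1F} {0F} ()
  above {1F} {1F} (s≤s ())
  above {2F} {0F} ()
  above {2F} {1F} (s≤s ())
  above {2F} {2F} (s≤s (s≤s ()))

not-interlaced : ∀ {k} {x y : Fin k → ℕ} i j → x i < y i → y j < x j → ¬ (x ≺ y ⊎ y ≺ x)
not-interlaced i j _ y<x (inj₁ (x≤y , _)) = ℕₚ.<⇒≱ y<x (x≤y j)
not-interlaced i j x<y _ (inj₂ (y≤x , _)) = ℕₚ.<⇒≱ x<y (y≤x i)

opposite-< : ∀ {n} {i j : Fin n} → i F.< j → opposite j F.< opposite i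
opposite-< {i = i} {j} i<j = subst₂ _<_ (≡-sym (opposite-prop j)) (≡-sym (opposite-prop i))
  (ℕₚ.∸-monoʳ-< (s≤s i<j) (toℕ<n j))

opposite-injective : ∀ {n} {i j : Fin n} → opposite i ≡ opposite j → i ≡ j
opposite-injective {i = i} {j} eq =
  trans (≡-sym (opposite-involutive i)) (trans (cong opposite eq) (opposite-involutive j))

-- Insertion times on three rounds of the clique.

-- K is the length of a round, g the common point of the outer gaps, and R the number of ranks.
module Timing (K g R : ℕ) where

  Valid : Shape → Set
  Valid (point p) = p < K
  Valid (inner a b) = a ≤ K × b ≤ K
  Valid (outer c d) = c ≤ g × g ≤ d × d ≤ K

  start≤K : ∀ s → Valid s → start s ≤ K
  start≤K (point p) p<K = ℕₚ.<⇒≤ p<K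
  start≤K (inner a b) (a≤K , _) = a≤K
  start≤K (outer c d) (c≤g , g≤d , d≤K) = ≤-trans c≤g (≤-trans g≤d d≤K)

  -- Insertions at slot p come before the clique letter at p, hence class 6 for points.
  slot : Shape → Fin 3 → ℕ
  slot (point p) 0F = p
  slot (point p) 1F = K + p
  slot (point p) 2F = K + (K + p)
  slot (inner a b) 0F = a
  slot (inner a b) 1F = K
  slot (inner a b) 2F = K + b
  slot (outer c d) 0F = c
  slot (outer c d) 1F = K + d
  slot (outer c d) 2F = K + (K + g)

  -- Breaks ties within a slot. Within each kind of insertion the classes increase, so coinciding
  -- slots keep their order. The choices 0 < 1 and 3 < 4 settle `inner-outer` when the gaps share
  -- only an endpoint.
  class : Shape → Fin 3 → Fin 7
  class (point _) _ = # 6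
  class (inner _ _) 0F = # 1
  class (inner _ _) 1F = # 2
  class (inner _ _) 2F = # 3
  class (outer _ _) 0F = # 0
  class (outer _ _) 1F = # 4
  class (outer _ _) 2F = # 5

  -- The classes inserted at the shared slots K and K + (K + g).
  Reversed : Fin 7 → Bool
  Reversed c = ⌊ c ≟ # 2 ⌋ ∨ ⌊ c ≟ # 5 ⌋

  fine : Fin 7 → Fin R → Fin R
  fine c r = if Reversed c then opposite r else r

  fine-injective : ∀ c {r r′} → fine c r ≡ fine c r′ → r ≡ r′
  fine-injective c eq with Reversed c
  ... | true = opposite-injective eq
  ... | false = eq

  opaque
    time : Shape → Fin R → Fin 3 → ℕ
    time s r j = lex R (lex 7 (slot s j) (class s j)) (fine (class s j) r)

    time-injective : ∀ {s s′ r r′ i j} → time s r i ≡ time s′ r′ j → r ≡ r′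
    time-injective {s} {s′} {r} {r′} {i} {j} eq
      with m≡ , fine≡ ← lex-injective (lex 7 (slot s i) (class s i)) (lex 7 (slot s′ j) (class s′ j)) _ _ eq
      with _ , class≡ ← lex-injective (slot s i) (slot s′ j) _ _ m≡ =
      fine-injective (class s i) (trans fine≡ (cong (λ c → fine c r′) (≡-sym class≡)))

    slot-time : ∀ {s s′ r r′ i j} → slot s i < slot s′ j → time s r i < time s′ r′ j
    slot-time {s} {s′} {i = i} {j} lt =
      lex-<ˡ {m = lex 7 (slot s i) (class s i)} (lex-<ˡ lt (class s i) (class s′ j)) _ _

    class-time : ∀ {s s′ r r′ i j} → {{True (class s i F.<? class s′ j)}} →
      slot s i ≤ slot s′ j → time s r i < time s′ r′ j
    class-time {s} {i = i} {{lt}} le =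
      lex-<ˡ {m = lex 7 (slot s i) (class s i)} (lex-<ʳ le (toWitness lt)) _ _

    fine-time : ∀ {s s′ r r′ i j} → class s i ≡ class s′ j → slot s i ≤ slot s′ j →
      fine (class s i) r F.< fine (class s′ j) r′ → time s r i < time s′ r′ j
    fine-time {s} {i = i} class≡ le lt = lex-<ʳ
      (ℕₚ.+-mono-≤ (ℕₚ.*-monoˡ-≤ 7 le) (≤-reflexive (cong toℕ class≡))) lt

  time-slot : ∀ {s s′ r r′ i j} → time s r i ≤ time s′ r′ j → slot s i ≤ slot s′ j
  time-slot le = ℕₚ.≮⇒≥ λ lt → ℕₚ.<⇒≱ (slot-time lt) le

  -- At equal slots the larger class would make the left time the later one.
  time-slot-< : ∀ {s s′ r r′ i j} → {{True (class s′ j F.<? class s i)}} →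
    time s r i ≤ time s′ r′ j → slot s i < slot s′ j
  time-slot-< le = ℕₚ.≰⇒> λ slot≥ → ℕₚ.<⇒≱ (class-time slot≥) le

  _≺≻_ : (Fin 3 → ℕ) → (Fin 3 → ℕ) → Set
  x ≺≻ y = x ≺ y ⊎ y ≺ x

  point-point : ∀ {p q r r′} → p < q → q < K → time (point p) r ≺ time (point q) r′
  point-point {p} {q} {r} {r′} p<q q<K = interlaced (time (point p) r) (time (point q) r′)
    (slot-time p<q)
    (slot-time (ℕₚ.<-≤-trans q<K (ℕₚ.m≤m+n K p)))
    (slot-time (ℕₚ.+-monoʳ-< K p<q))
    (slot-time
      (ℕₚ.+-monoʳ-< K (ℕₚ.<-≤-trans q<K (ℕₚ.m≤m+n K p))))
    (slot-time (ℕₚ.+-monoʳ-< K (ℕₚ.+-monoʳ-< K p<q)))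

  point-inner : ∀ {p a b r r′} → p < K → b ≤ K →
    (a ≤ p × p < b) ⇔ (time (point p) r ≺≻ time (inner a b) r′)
  point-inner {p} {a} {b} {r} {r′} p<K b≤K = mk⇔ to from
    where
    X = time (point p) r
    Y = time (inner a b) r′

    -- The insertion at K precedes the whole second round, so only the inner letter can lead.
    Y₁<X₁ : Y 1F < X 1F
    Y₁<X₁ = class-time (ℕₚ.m≤m+n K p)

    to : a ≤ p × p < b → X ≺≻ Y
    to (a≤p , p<b) = inj₂ (interlaced Y X
      (class-time a≤p)
      (slot-time p<K)
      Y₁<X₁
      (slot-time (ℕₚ.+-monoʳ-< K p<b))
      (class-time
        (ℕₚ.+-monoʳ-≤ K (≤-trans b≤K (ℕₚ.m≤m+n K p)))))

    from : X ≺≻ Y → a ≤ p × p < b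
    from (inj₁ (X≤Y , _)) = ⊥-elim (ℕₚ.<⇒≱ Y₁<X₁ (X≤Y 1F))
    from (inj₂ (Y≤X , X≤Y)) =
      time-slot (Y≤X 0F) ,
      ℕₚ.+-cancelˡ-< K p b
        (time-slot-< (X≤Y {1F} {2F} ≤-refl))

  -- All three insertions lie in the gap [c, d], so a point left of it leads in every round and a
  -- point right of it follows in every round. Conversely, the first round tests p against c and the
  -- second tests it against d.
  point-outer : ∀ {p c d r r′} → p < K → Valid (outer c d) →
    (p < c ⊎ d ≤ p) ⇔ (time (point p) r ≺≻ time (outer c d) r′)
  point-outer {p} {c} {d} {r} {r′} p<K (c≤g , g≤d , d≤K) = mk⇔ to from
    where
    X = time (point p) r
    Y = time (outer c d) r′

    to : p < c ⊎ d ≤ p → X ≺≻ Y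
    to (inj₁ p<c) = inj₁ (interlaced X Y
      (slot-time p<c)
      (class-time
        (≤-trans c≤g (≤-trans g≤d (≤-trans d≤K (ℕₚ.m≤m+n K p)))))
      (slot-time
        (ℕₚ.+-monoʳ-< K (ℕₚ.<-≤-trans p<c (≤-trans c≤g g≤d))))
      (class-time
        (ℕₚ.+-monoʳ-≤ K (≤-trans d≤K (ℕₚ.m≤m+n K p))))
      (slot-time
        (ℕₚ.+-monoʳ-< K (ℕₚ.+-monoʳ-< K (ℕₚ.<-≤-trans p<c c≤g)))))
    to (inj₂ d≤p) = inj₂ (interlaced Y X
      (class-time (≤-trans c≤g (≤-trans g≤d d≤p)))
      (slot-time (ℕₚ.<-≤-trans p<K (ℕₚ.m≤m+n K d)))
      (class-time (ℕₚ.+-monoʳ-≤ K d≤p))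
      (slot-time
        (ℕₚ.+-monoʳ-< K (ℕₚ.<-≤-trans p<K (ℕₚ.m≤m+n K g))))
      (class-time
        (ℕₚ.+-monoʳ-≤ K (ℕₚ.+-monoʳ-≤ K (≤-trans g≤d d≤p)))))

    from : X ≺≻ Y → p < c ⊎ d ≤ p
    from (inj₁ (X≤Y , _)) = inj₁ (time-slot-< (X≤Y 0F))
    from (inj₂ (Y≤X , _)) = inj₂ (ℕₚ.+-cancelˡ-≤ K d p
      (time-slot (Y≤X 1F)))

  -- The second insertions share the slot K, where the reversed ranks undo the order of the first
  -- ones.
  inner-inner : ∀ {a b a′ b′ r r′} → a ≤ a′ → r F.< r′ →
    ¬ (time (inner a b) r ≺≻ time (inner a′ b′) r′)
  inner-inner {a} {b} {a′} {b′} a≤a′ r<r′ = not-interlaced 0F 1F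
    (fine-time refl a≤a′ r<r′)
    (fine-time refl ≤-refl (opposite-< r<r′))

  -- As for `inner-inner`, with the third insertions at the common slot given by g.
  outer-outer : ∀ {c d c′ d′ r r′} → c ≤ c′ → r F.< r′ →
    ¬ (time (outer c d) r ≺≻ time (outer c′ d′) r′)
  outer-outer {c} {d} {c′} {d′} c≤c′ r<r′ = not-interlaced 0F 2F
    (fine-time refl c≤c′ r<r′)
    (fine-time refl ≤-refl (opposite-< r<r′))

  inner-outer : ∀ {a b c d r r′} → c ≤ a ⊎ b ≤ d →
    ¬ (time (inner a b) r ≺≻ time (outer c d) r′)
  inner-outer {a} {b} {c} {d} {r} {r′} meet with ℕₚ.≤-<-connex c a
  -- The outer letter is earlier in its first insertion, the inner letter in its second.
  ... | inj₁ c≤a = not-interlaced 1F 0F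
          (class-time (ℕₚ.m≤m+n K d))
          (class-time c≤a)
  -- Now the inner letter would have to lead, yet its third insertion precedes the second one of the
  -- outer letter.
  ... | inj₂ a<c = λ
          { (inj₁ (_ , Y≤X)) → ℕₚ.<⇒≱ X₂<Y₁ (Y≤X {1F} {2F} ≤-refl)
          ; (inj₂ (Y≤X , _)) → ℕₚ.<⇒≱ (slot-time a<c) (Y≤X 0F) }
    where
    b≤d : b ≤ d
    b≤d = [ (λ c≤a → ⊥-elim (ℕₚ.<⇒≱ a<c c≤a)) , (λ b≤d → b≤d) ]′ meet

    X₂<Y₁ : time (inner a b) r 2F < time (outer c d) r′ 1F
    X₂<Y₁ = class-time (ℕₚ.+-monoʳ-≤ K b≤d)

  Aligned : Shape → Fin R → Shape → Fin R → Set
  Aligned s r s′ r′ = start s ≤ start s′ × r F.< r′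

  touch⇔ : ∀ s s′ {r r′} → Valid s → Valid s′ → Compatible s s′ →
    Aligned s r s′ r′ ⊎ Aligned s′ r′ s r → Touch s s′ ⇔ (time s r ≺≻ time s′ r′)
  touch⇔ (point p) (point q) p<K q<K p≢q _ with ℕₚ.<-cmp p q
  ... | tri< p<q _ _ = mk⇔ (λ _ → inj₁ (point-point p<q q<K)) _
  ... | tri≈ _ p≡q _ = ⊥-elim (p≢q p≡q)
  ... | tri> _ _ q<p = mk⇔ (λ _ → inj₂ (point-point q<p p<K)) _
  touch⇔ (point p) (inner a b) p<K (_ , b≤K) _ _ = point-inner p<K b≤K
  touch⇔ (inner a b) (point p) (_ , b≤K) p<K _ _ = mk⇔ (swap ∘ to) (from ∘ swap)
    where open Equivalence (point-inner p<K b≤K)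
  touch⇔ (point p) (outer c d) p<K valid _ _ = point-outer p<K valid
  touch⇔ (outer c d) (point p) valid p<K _ _ = mk⇔ (swap ∘ to) (from ∘ swap)
    where open Equivalence (point-outer p<K valid)
  touch⇔ (inner _ _) (inner _ _) _ _ _ (inj₁ (le , lt)) = mk⇔ (λ ()) (inner-inner le lt)
  touch⇔ (inner _ _) (inner _ _) _ _ _ (inj₂ (le , lt)) = mk⇔ (λ ()) (inner-inner le lt ∘ swap)
  touch⇔ (outer _ _) (outer _ _) _ _ _ (inj₁ (le , lt)) = mk⇔ (λ ()) (outer-outer le lt)
  touch⇔ (outer _ _) (outer _ _) _ _ _ (inj₂ (le , lt)) = mk⇔ (λ ()) (outer-outer le lt ∘ swap)
  touch⇔ (inner _ _) (outer _ _) _ _ meet _ = mk⇔ (λ ()) (inner-outer meet)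
  touch⇔ (outer _ _) (inner _ _) _ _ meet _ = mk⇔ (λ ()) (inner-outer meet ∘ swap)

  time-mono : ∀ s {r} → Valid s → ∀ {i j} → i F.< j → time s r i < time s r j
  time-mono (point p) {r} p<K = ascending (time (point p) r)
    (slot-time (ℕₚ.<-≤-trans p<K (ℕₚ.m≤m+n K p)))
    (slot-time
      (ℕₚ.+-monoʳ-< K (ℕₚ.<-≤-trans p<K (ℕₚ.m≤m+n K p))))
  time-mono (inner a b) {r} (a≤K , _) = ascending (time (inner a b) r)
    (class-time a≤K)
    (class-time (ℕₚ.m≤m+n K b))
  time-mono (outer c d) {r} (c≤g , g≤d , d≤K) = ascending (time (outer c d) r)
    (class-time
      (≤-trans c≤g (≤-trans g≤d (≤-trans d≤K (ℕₚ.m≤m+n K d)))))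
    (class-time
      (ℕₚ.+-monoʳ-≤ K (≤-trans d≤K (ℕₚ.m≤m+n K g))))

-- Extrema over decidable sets.

-- One more than the maximum of f on P, or 0 if P is empty.
upper : ∀ {n} {P : Fin n → Set} → Decidable P → (Fin n → ℕ) → ℕ
upper {zero} P? f = 0
upper {suc n} P? f with P? 0F
... | yes _ = suc (f 0F) ⊔ upper (P? ∘ suc) (f ∘ suc)
... | no _ = upper (P? ∘ suc) (f ∘ suc)

<upper : ∀ {n} {P : Fin n → Set} (P? : Decidable P) f {i} → P i → f i < upper P? f
<upper P? f {0F} p with P? 0F
... | yes _ = ℕₚ.m≤m⊔n (suc (f 0F)) (upper (P? ∘ suc) (f ∘ suc))
... | no ¬p = ⊥-elim (¬p p)
<upper P? f {suc i} p with P? 0F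
... | yes _ = ≤-trans (<upper (P? ∘ suc) (f ∘ suc) p) (ℕₚ.m≤n⊔m (suc (f 0F)) _)
... | no _ = <upper (P? ∘ suc) (f ∘ suc) p

upper-attained : ∀ {n} {P : Fin n → Set} (P? : Decidable P) f {m} → m < upper P? f → ∃[ i ] P i × m ≤ f i
upper-attained {suc n} P? f {m} lt with P? 0F
... | no _ = let i , p , le = upper-attained (P? ∘ suc) (f ∘ suc) lt in suc i , p , le
... | yes p with ℕₚ.⊔-sel (suc (f 0F)) (upper (P? ∘ suc) (f ∘ suc))
...   | inj₁ eq = 0F , p , s≤s⁻¹ (subst (m <_) eq lt)
...   | inj₂ eq = let i , q , le = upper-attained (P? ∘ suc) (f ∘ suc) (subst (m <_) eq lt) in suc i , q , le

-- The minimum of f on P capped by top, hence top if P is empty.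
lower : ∀ {n} {P : Fin n → Set} → Decidable P → (Fin n → ℕ) → ℕ → ℕ
lower {zero} P? f top = top
lower {suc n} P? f top with P? 0F
... | yes _ = f 0F ⊓ lower (P? ∘ suc) (f ∘ suc) top
... | no _ = lower (P? ∘ suc) (f ∘ suc) top

lower≤top : ∀ {n} {P : Fin n → Set} (P? : Decidable P) f {top} → lower P? f top ≤ top
lower≤top {zero} P? f = ≤-refl
lower≤top {suc n} P? f with P? 0F
... | yes _ = ≤-trans (ℕₚ.m⊓n≤n (f 0F) _) (lower≤top (P? ∘ suc) (f ∘ suc))
... | no _ = lower≤top (P? ∘ suc) (f ∘ suc)

lower≤ : ∀ {n} {P : Fin n → Set} (P? : Decidable P) f {top i} → P i → lower P? f top ≤ f i
lower≤ P? f {i = 0F} p with P? 0F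
... | yes _ = ℕₚ.m⊓n≤m _ _
... | no ¬p = ⊥-elim (¬p p)
lower≤ P? f {i = suc i} p with P? 0F
... | yes _ = ≤-trans (ℕₚ.m⊓n≤n (f 0F) _) (lower≤ (P? ∘ suc) (f ∘ suc) p)
... | no _ = lower≤ (P? ∘ suc) (f ∘ suc) p

lower-attained : ∀ {n} {P : Fin n → Set} (P? : Decidable P) f {top m} →
  m < top → lower P? f top ≤ m → ∃[ i ] P i × f i ≤ m
lower-attained {zero} P? f m<top le = ⊥-elim (ℕₚ.<⇒≱ m<top le)
lower-attained {suc n} P? f m<top le with P? 0F
... | no _ = let i , p , le′ = lower-attained (P? ∘ suc) (f ∘ suc) m<top le in suc i , p , le′
... | yes p with ℕₚ.⊓-sel (f 0F) (lower (P? ∘ suc) (f ∘ suc) _)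
...   | inj₁ eq = 0F , p , subst (_≤ _) eq le
...   | inj₂ eq = let i , q , le′ = lower-attained (P? ∘ suc) (f ∘ suc) m<top (subst (_≤ _) eq le) in suc i , q , le′

-- Neighbourhoods in the order of first occurrence.

module Layout {n} (G : Graph n) (inC : Fin n → Bool) (split : IsSplitPartition G inC)
  (w : Word n) (represents : Represents G w) where

  pos : Fin n → ℕ
  pos = first w

  -- The circle has room for every value of `pos`, also for letters missing from w; positions
  -- without a clique vertex stay empty.
  K : ℕ
  K = length w + n

  pos<K : ∀ a → pos a < K
  pos<K = first< w

  adj? : ∀ a b → Dec (Adj G a b)
  adj? a b with a ≟ b
  ... | yes refl = no (irrefl G)
  ... | no a≢b = map′ (proj₂ (represents a b a≢b)) (proj₁ (represents a b a≢b)) (alternating? (restrict a b w))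

  pos-<⇒≢ : ∀ {a b} → pos a < pos b → a ≢ b
  pos-<⇒≢ lt refl = ℕₚ.<-irrefl refl lt

  lead : ∀ {a b} → Adj G a b → pos a < pos b → Lead w a b
  lead {a} {b} adj lt with alternate⇒lead a≢b w (proj₁ (represents a b a≢b) adj)
    where a≢b = pos-<⇒≢ lt
  ... | inj₁ l = l
  ... | inj₂ l = lead-by-first lt l

  lead⇒adj : ∀ {a b} → a ≢ b → Lead w a b → Adj G a b
  lead⇒adj {a} {b} a≢b l = proj₂ (represents a b a≢b) (lead⇒alternate a≢b w (inj₁ l))

  infixr 5 _⨾_
  _⨾_ : ∀ {a b c} → Dominates w a b → Dominates w b c → Dominates w a c
  (ab ⨾ bc) p s eq = ≤-trans (bc p s eq) (ab p s eq)

  itself : ∀ {a} → Dominates w a a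
  itself p s eq = ≤-refl

  Clique Independent : Fin n → Set
  Clique a = inC a ≡ true
  Independent a = inC a ≡ false

  clique-adj : ∀ {a b} → Clique a → Clique b → pos a < pos b → Adj G a b
  clique-adj ca cb lt = proj₁ split _ _ ca cb (pos-<⇒≢ lt)

  clique-dominates : ∀ {a b} → Clique a → Clique b → pos a ≤ pos b → Dominates w a b
  clique-dominates ca cb le with ℕₚ.m≤n⇒m<n∨m≡n le
  ... | inj₁ lt = lead⇒dominates (lead (clique-adj ca cb lt) lt)
  ... | inj₂ eq with refl ← first-injective w eq = itself

  clique≢independent : ∀ {a x} → Clique a → Independent x → a ≢ x
  clique≢independent ca ix refl with () ← trans (≡-sym ca) ix

  neighbour-clique : ∀ {a x} → Independent x → Adj G a x → Clique a
  neighbour-clique {a} ix adj with inC a in eq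
  ... | true = refl
  ... | false = ⊥-elim (proj₂ split _ _ eq ix adj)

  no-lead : ∀ {x y} → Independent x → Independent y → x ≢ y → ¬ Lead w x y
  no-lead ix iy x≢y l = proj₂ split _ _ ix iy (lead⇒adj x≢y l)

  Before After : Fin n → Fin n → Set
  Before x u = Adj G u x × pos u < pos x
  After x u = Adj G u x × pos x < pos u

  before-dominates : ∀ {x u} → Before x u → Dominates w u x
  before-dominates (adj , lt) = lead⇒dominates (lead adj lt)

  after-dominates : ∀ {x u} → After x u → Dominates w x u
  after-dominates (adj , lt) = lead⇒dominates (lead (Graph.sym G adj) lt)

  side : ∀ {x u} → Adj G u x → Before x u ⊎ After x u
  side {x} {u} adj with ℕₚ.<-cmp (pos u) (pos x)
  ... | tri< lt _ _ = inj₁ (adj , lt)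
  ... | tri≈ _ eq _ with refl ← first-injective w eq = ⊥-elim (irrefl G adj)
  ... | tri> _ _ gt = inj₂ (adj , gt)

  -- Each lemma applies `squeeze` to a path with adjacent ends. In order, the paths are c, u, x, v;
  -- then u, x, v, c; then u, c, v, x; then x, u, c, v.
  module _ {x} (ix : Independent x) where

    before-initial : ∀ {u v c} → Before x u → After x v → Clique c → pos c ≤ pos u → Adj G c x
    before-initial bu@(u~x , u<x) av@(v~x , x<v) cc c≤u = lead⇒adj c≢x (squeeze c≢x
      (lead (clique-adj cc (neighbour-clique ix v~x) c<v) c<v)
      itself
      (clique-dominates cc (neighbour-clique ix u~x) c≤u ⨾ before-dominates bu)
      (after-dominates av))
      where
      c≢x = clique≢independent cc ix
      c<v = ℕₚ.≤-<-trans c≤u (ℕₚ.<-trans u<x x<v)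

    after-final : ∀ {u v c} → Before x u → After x v → Clique c → pos v ≤ pos c → Adj G c x
    after-final bu@(u~x , u<x) av@(v~x , x<v) cc v≤c = Graph.sym G (lead⇒adj x≢c (squeeze x≢c
      (lead (clique-adj (neighbour-clique ix u~x) cc u<c) u<c)
      (before-dominates bu)
      (after-dominates av ⨾ clique-dominates (neighbour-clique ix v~x) cc v≤c)
      itself))
      where
      x≢c = ≢-sym (clique≢independent cc ix)
      u<c = ℕₚ.<-≤-trans (ℕₚ.<-trans u<x x<v) v≤c

    before-convex : ∀ {u v c} → Before x u → Before x v → Clique c → pos u ≤ pos c → pos c ≤ pos v → Adj G c x
    before-convex (u~x , u<x) bv@(v~x , _) cc u≤c c≤v = lead⇒adj c≢x (squeeze c≢x
      (lead u~x u<x)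
      (clique-dominates (neighbour-clique ix u~x) cc u≤c)
      (clique-dominates cc (neighbour-clique ix v~x) c≤v ⨾ before-dominates bv)
      itself)
      where c≢x = clique≢independent cc ix

    after-convex : ∀ {u v c} → After x u → After x v → Clique c → pos u ≤ pos c → pos c ≤ pos v → Adj G c x
    after-convex au@(u~x , _) (v~x , x<v) cc u≤c c≤v = Graph.sym G (lead⇒adj x≢c (squeeze x≢c
      (lead (Graph.sym G v~x) x<v)
      itself
      (after-dominates au ⨾ clique-dominates (neighbour-clique ix u~x) cc u≤c)
      (clique-dominates cc (neighbour-clique ix v~x) c≤v)))
      where x≢c = ≢-sym (clique≢independent cc ix)

  -- Otherwise y, v′, u, x, v would be a path in this order. Then `after-final` joins y to v, and
  -- `squeeze` makes the independent y and x alternate.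
  gaps-meet : ∀ {x y u v u′ v′} → Independent x → Independent y →
    Before x u → After x v → Before y u′ → After y v′ → pos u < pos v′
  gaps-meet ix iy bu@(u~x , u<x) av@(v~x , x<v) bu′ av′@(v′~y , y<v′) = ℕₚ.≰⇒> λ v′≤u →
    let y<x = ℕₚ.<-≤-trans y<v′ (≤-trans v′≤u (ℕₚ.<⇒≤ u<x))
        cv = neighbour-clique ix v~x
        v~y = after-final iy bu′ av′ cv (≤-trans v′≤u (ℕₚ.<⇒≤ (ℕₚ.<-trans u<x x<v)))
    in no-lead iy ix (pos-<⇒≢ y<x) (squeeze (pos-<⇒≢ y<x)
         (lead (Graph.sym G v~y) (ℕₚ.<-trans y<x x<v))
         itself
         (after-dominates av′ ⨾ clique-dominates (neighbour-clique iy v′~y) (neighbour-clique ix u~x) v′≤u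
           ⨾ before-dominates bu)
         (after-dominates av))

  -- The paths for `squeeze` are u, y, v, x and x, u, y, v; both would make x and y alternate.
  module _ {x y u v} (ix : Independent x) (iy : Independent y) (bu : Before y u) (av : After y v) where

    before-not-around : Before x u → Before x v → ⊥
    before-not-around (u~x , u<x) bv = no-lead iy ix y≢x (squeeze y≢x
      (lead u~x u<x) (before-dominates bu) (after-dominates av ⨾ before-dominates bv) itself)
      where y≢x = pos-<⇒≢ (ℕₚ.<-trans (proj₂ av) (proj₂ bv))

    after-not-around : After x u → After x v → ⊥
    after-not-around au (v~x , x<v) = no-lead ix iy x≢y (squeeze x≢y
      (lead (Graph.sym G v~x) x<v) itself (after-dominates au ⨾ before-dominates bu) (after-dominates av))
      where x≢y = pos-<⇒≢ (ℕₚ.<-trans (proj₂ au) (proj₂ bu))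

  neighbour? : ∀ x → Decidable (λ u → Adj G u x)
  neighbour? x u = adj? u x

  before? : ∀ x → Decidable (Before x)
  before? x u = adj? u x ×-dec (pos u ℕₚ.<? pos x)

  after? : ∀ x → Decidable (After x)
  after? x u = adj? u x ×-dec (pos x ℕₚ.<? pos u)

  -- Only the last neighbour before x bounds its gap, but admitting all of them leaves the maximum
  -- unchanged.
  GapStart : Fin n → Set
  GapStart u = ∃[ x ] Independent x × Before x u × ∃ (After x)

  gapStart? : Decidable GapStart
  gapStart? u = any? λ x → (inC x Boolₚ.≟ false) ×-dec before? x u ×-dec any? (after? x)

  -- The rightmost left end of the gaps not containing the origin.
  g : ℕ
  g = upper gapStart? pos

  -- A rank is a start between 0 and K together with a vertex that breaks ties.
  R : ℕ
  R = suc K * n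

  open Timing K g R

  -- Placing the vertices on the circle.

  data Placed (x : Fin n) : Shape → Set where
    member : Clique x → Placed x (point (pos x))
    straddling : Independent x → ∃ (Before x) → ∃ (After x) →
      Placed x (outer (upper (before? x) pos) (lower (after? x) pos K))
    -- Without neighbours the defaults give `inner K 0`, an empty interval.
    one-sided : Independent x → ¬ (∃ (Before x) × ∃ (After x)) →
      Placed x (inner (lower (neighbour? x) pos K) (upper (neighbour? x) pos))

  place : ∀ x → ∃ (Placed x)
  place x with inC x in eq
  ... | true = _ , member eq
  ... | false with any? (before? x) ×-dec any? (after? x)
  ...   | yes (before , after) = _ , straddling eq before after
  ...   | no ¬both = _ , one-sided eq ¬both

  upper≤K : ∀ {P : Fin n → Set} (P? : Decidable P) → upper P? pos ≤ K
  upper≤K P? = ℕₚ.≮⇒≥ λ lt → let i , _ , le = upper-attained P? pos lt in ℕₚ.<⇒≱ (pos<K i) le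

  -- Helly's theorem on a line: g is the greatest left end, and by `gaps-meet` no right end lies
  -- below any left end.
  placed-valid : ∀ {x s} → Placed x s → Valid s
  placed-valid (member _) = pos<K _
  placed-valid {x} (one-sided _ _) = lower≤top (neighbour? x) pos , upper≤K (neighbour? x)
  placed-valid {x} (straddling ix (u₀ , bu₀) after) = ℕₚ.≮⇒≥ c≯g , ℕₚ.≮⇒≥ g≯d , lower≤top (after? x) pos
    where
    c≯g : ¬ g < upper (before? x) pos
    c≯g lt = let u , bu , g≤u = upper-attained (before? x) pos lt in
      ℕₚ.<⇒≱ (<upper gapStart? pos (x , ix , bu , after)) g≤u

    g≯d : ¬ lower (after? x) pos K < g
    g≯d lt =
      let u , (y , iy , bu , v , av) , d≤u = upper-attained gapStart? pos lt
          v′ , av′ , v′≤u = lower-attained (after? x) pos (pos<K u) d≤u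
      in ℕₚ.<⇒≱ (gaps-meet iy ix bu av bu₀ av′) v′≤u

  member-straddling : ∀ {c x} → Clique c → Independent x → ∃ (Before x) → ∃ (After x) →
    Adj G c x ⇔ (pos c < upper (before? x) pos ⊎ lower (after? x) pos K ≤ pos c)
  member-straddling {c} {x} cc ix (u₀ , bu₀) (v₀ , av₀) = mk⇔
    (Sum.map (<upper (before? x) pos) (lower≤ (after? x) pos) ∘ side)
    [ (λ lt → let u , bu , c≤u = upper-attained (before? x) pos lt in before-initial ix bu av₀ cc c≤u)
    , (λ le → let v , av , v≤c = lower-attained (after? x) pos (pos<K c) le in after-final ix bu₀ av cc v≤c) ]′

  member-one-sided : ∀ {c x} → Clique c → Independent x → ¬ (∃ (Before x) × ∃ (After x)) →
    Adj G c x ⇔ (lower (neighbour? x) pos K ≤ pos c × pos c < upper (neighbour? x) pos)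
  member-one-sided {c} {x} cc ix ¬both = mk⇔
    (λ adj → lower≤ (neighbour? x) pos adj , <upper (neighbour? x) pos adj)
    convex
    where
    convex : lower (neighbour? x) pos K ≤ pos c × pos c < upper (neighbour? x) pos → Adj G c x
    convex (le , lt)
      with u , u~x , u≤c ← lower-attained (neighbour? x) pos (pos<K c) le
      with v , v~x , c≤v ← upper-attained (neighbour? x) pos lt
      with side u~x | side v~x
    ... | inj₁ bu | inj₁ bv = before-convex ix bu bv cc u≤c c≤v
    ... | inj₂ au | inj₂ av = after-convex ix au av cc u≤c c≤v
    ... | inj₁ bu | inj₂ av = ⊥-elim (¬both ((u , bu) , (v , av)))
    ... | inj₂ au | inj₁ bv = ⊥-elim (¬both ((v , bv) , (u , au)))

  -- If the gaps were disjoint, x would have neighbours u to the left and v to the right of the gap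
  -- of y. Both are then adjacent to y. As x is one-sided, u and v lie on the same side of x, which
  -- `before-not-around` and `after-not-around` exclude.
  one-sided-straddling : ∀ {x y} → Independent x → ¬ (∃ (Before x) × ∃ (After x)) →
    Independent y → ∃ (Before y) → ∃ (After y) →
    upper (before? y) pos ≤ lower (neighbour? x) pos K ⊎ upper (neighbour? x) pos ≤ lower (after? y) pos K
  one-sided-straddling {x} {y} ix ¬both iy (u₀ , bu₀) (v₀ , av₀)
    with ℕₚ.≤-<-connex (upper (before? y) pos) (lower (neighbour? x) pos K)
       | ℕₚ.≤-<-connex (upper (neighbour? x) pos) (lower (after? y) pos K)
  ... | inj₁ c≤a | _ = inj₁ c≤a
  ... | _ | inj₁ b≤d = inj₂ b≤d
  ... | inj₂ a<c | inj₂ d<b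
    with u₁ , bu₁ , a≤u₁ ← upper-attained (before? y) pos a<c
    with u , u~x , u≤u₁ ← lower-attained (neighbour? x) pos (pos<K u₁) a≤u₁
    with v , v~x , d≤v ← upper-attained (neighbour? x) pos d<b
    with v₁ , av₁ , v₁≤v ← lower-attained (after? y) pos (pos<K v) d≤v
    = ⊥-elim (same-side (side u~x) (side v~x))
    where
    bu : Before y u
    bu = before-initial iy bu₁ av₀ (neighbour-clique ix u~x) u≤u₁ , ℕₚ.≤-<-trans u≤u₁ (proj₂ bu₁)

    av : After y v
    av = after-final iy bu₀ av₁ (neighbour-clique ix v~x) v₁≤v , ℕₚ.<-≤-trans (proj₂ av₁) v₁≤v

    same-side : Before x u ⊎ After x u → Before x v ⊎ After x v → ⊥
    same-side (inj₁ bxu) (inj₁ bxv) = before-not-around ix iy bu av bxu bxv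
    same-side (inj₂ axu) (inj₂ axv) = after-not-around ix iy bu av axu axv
    same-side (inj₁ bxu) (inj₂ axv) = ¬both ((u , bxu) , (v , axv))
    same-side (inj₂ axu) (inj₁ bxv) = ¬both ((v , bxv) , (u , axu))

  placed-compatible : ∀ {x y s t} → x ≢ y → Placed x s → Placed y t → Compatible s t
  placed-compatible x≢y (member _) (member _) = x≢y ∘ first-injective w
  placed-compatible _ (one-sided ix ¬both) (straddling iy before after) =
    one-sided-straddling ix ¬both iy before after
  placed-compatible _ (straddling ix before after) (one-sided iy ¬both) =
    one-sided-straddling iy ¬both ix before after
  placed-compatible _ (member _) (straddling _ _ _) = tt
  placed-compatible _ (member _) (one-sided _ _) = tt
  placed-compatible _ (straddling _ _ _) (member _) = tt
  placed-compatible _ (straddling _ _ _) (straddling _ _ _) = tt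
  placed-compatible _ (one-sided _ _) (member _) = tt
  placed-compatible _ (one-sided _ _) (one-sided _ _) = tt

  placed-touch : ∀ {x y s t} → x ≢ y → Placed x s → Placed y t → Adj G x y ⇔ Touch s t
  placed-touch x≢y (member cx) (member cy) = mk⇔ _ (λ _ → proj₁ split _ _ cx cy x≢y)
  placed-touch _ (member cx) (straddling iy before after) = member-straddling cx iy before after
  placed-touch _ (member cx) (one-sided iy ¬both) = member-one-sided cx iy ¬both
  placed-touch _ (straddling ix before after) (member cy) = mk⇔ (to ∘ Graph.sym G) (Graph.sym G ∘ from)
    where open Equivalence (member-straddling cy ix before after)
  placed-touch _ (one-sided ix ¬both) (member cy) = mk⇔ (to ∘ Graph.sym G) (Graph.sym G ∘ from)
    where open Equivalence (member-one-sided cy ix ¬both)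
  placed-touch _ (straddling ix _ _) (straddling iy _ _) = mk⇔ (proj₂ split _ _ ix iy) λ ()
  placed-touch _ (straddling ix _ _) (one-sided iy _) = mk⇔ (proj₂ split _ _ ix iy) λ ()
  placed-touch _ (one-sided ix _) (straddling iy _ _) = mk⇔ (proj₂ split _ _ ix iy) λ ()
  placed-touch _ (one-sided ix _) (one-sided iy _) = mk⇔ (proj₂ split _ _ ix iy) λ ()

  -- Ranks, keys and the 3-uniform word.

  shape : Fin n → Shape
  shape x = proj₁ (place x)

  valid : ∀ x → Valid (shape x)
  valid x = placed-valid (proj₂ (place x))

  startF : Fin n → Fin (suc K)
  startF x = fromℕ< (s≤s (start≤K (shape x) (valid x)))

  rank : Fin n → Fin R
  rank x = combine (startF x) x

  rank-injective : ∀ {x y} → rank x ≡ rank y → x ≡ y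
  rank-injective {x} {y} = Fₚ.combine-injectiveʳ (startF x) x (startF y) y

  rank-start : ∀ {x y} → rank x F.< rank y → start (shape x) ≤ start (shape y)
  rank-start {x} {y} lt = subst₂ _≤_ (toℕ-fromℕ< _) (toℕ-fromℕ< _)
    (ℕₚ.≮⇒≥ λ sy<sx → ℕₚ.<-asym lt (Fₚ.combine-monoˡ-< {i = startF y} {startF x} y x sy<sx))

  aligned : ∀ {x y} → x ≢ y →
    Aligned (shape x) (rank x) (shape y) (rank y) ⊎ Aligned (shape y) (rank y) (shape x) (rank x)
  aligned {x} {y} x≢y with Fₚ.<-cmp (rank x) (rank y)
  ... | tri< lt _ _ = inj₁ (rank-start {x} {y} lt , lt)
  ... | tri≈ _ eq _ = ⊥-elim (x≢y (rank-injective eq))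
  ... | tri> _ _ gt = inj₂ (rank-start {y} {x} gt , gt)

  key : Fin n → Fin 3 → ℕ
  key x = time (shape x) (rank x)

  key-mono : ∀ x {i j} → i F.< j → key x i < key x j
  key-mono x = time-mono (shape x) (valid x)

  open Schedule key key-mono (λ i j eq → rank-injective (time-injective eq))

  end : ℕ
  end = upper {P = λ _ → ⊤} (λ _ → yes tt) (λ x → key x 2F)

  key<end : ∀ x j → key x j < end
  key<end x 2F = <upper {P = λ _ → ⊤} (λ _ → yes tt) (λ x → key x 2F) tt
  key<end x 0F = ℕₚ.<-trans (key-mono x (s≤s z≤n)) (key<end x 2F)
  key<end x 1F = ℕₚ.<-trans (key-mono x ≤-refl) (key<end x 2F)

  adj⇔≺≻ : ∀ {x y} → x ≢ y → Adj G x y ⇔ (key x ≺≻ key y)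
  adj⇔≺≻ {x} {y} x≢y =
    touch⇔ (shape x) (shape y) (valid x) (valid y) (placed-compatible x≢y px py) (aligned x≢y)
      ⇔-∘ placed-touch x≢y px py
    where
    px = proj₂ (place x)
    py = proj₂ (place y)

  play-represents : Represents G (play end)
  play-represents x y x≢y =
    (λ adj → lead⇒alternate x≢y (play end)
      (Sum.map (λ lt → ≺⇒lead x≢y lt end) (λ gt → ≺⇒lead (≢-sym x≢y) gt end) (to adj))) ,
    (λ alt → from (Sum.map (lead⇒≺ key<end) (lead⇒≺ key<end) (alternate⇒lead x≢y (play end) alt)))
    where open Equivalence (adj⇔≺≻ x≢y)

  3-representable : KRepresentable 3 G
  3-representable = play end , play-uniform key<end , play-represents

theorem5 : ∀ {n} (G : Graph n) → IsSplit G → WordRepresentable G →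
    ∃[ k ] (k ≤ 3 × KRepresentable k G)
theorem5 G (inC , split) (w , represents) = 3 , ≤-refl , 3-representable
  where open Layout G inC split w represents
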